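{- For $n \geq 3$, let $\mathcal{T}(n)$ be the class of trees that have a unique vertex of maximum degree, this maximum degree being $n+1$, and such that the removal of this vertex results in components that have maximum degree at most $n-1$. Then for every $n \geq 3$ and every $T \in \mathcal{T}(n)$, there is $k \in \mathbb{N}$ such that $\square^n K_k$ is $T$-induced-saturated.
   Context: All graphs are finite and simple; $\mathbb{N}=\{1,2,\dots\}$. For graphs $H,G$, write $H \subseteq_I G$ if $G$ contains an induced subgraph isomorphic to $H$. A graph $G$ on at least two vertices is $H$-induced-saturated if $H \not\subseteq_I G$, but $H \subseteq_I G - e$ for every edge $e \in E(G)$ and $H \subseteq_I G + e$ for every edge $e \in E(\overline{G})$ of the complement. $\square^n K_k$ is the Cartesian product of $n$ cliques of order $k$: its vertices are all $n$-tuples with entries in a fixed $k$-element set, two tuples being adjacent iff they differ in exactly one coordinate. -}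

module Defs where

open import Data.Bool.Base using (Bool; T; not)
open import Data.Bool.Properties using (T-irrelevant)
open import Data.Empty using (⊥-elim)
open import Data.Fin.Base using (Fin)
import Data.Fin.Properties as Fin
open import Data.List.Base as List
  using (List; []; _∷_; _∷ʳ_; length; filter; allFin; cartesianProductWith)
open import Data.List.Extrema.Nat using (max)
open import Data.List.Membership.Propositional using (_∈_)
open import Data.List.Membership.Propositional.Properties
  using (∈-allFin; ∈-cartesianProductWith⁺)
open import Data.List.Relation.Unary.All using (All; []; _∷_)
open import Data.List.Relation.Unary.AllPairs using ([]; _∷_)
open import Data.List.Relation.Unary.Any using (here; there)
open import Data.List.Relation.Unary.Linked using (Linked)
open import Data.List.Relation.Unary.Unique.Propositional using (Unique)
import Data.List.Relation.Unary.Unique.Propositional.Properties as Unique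
open import Data.Nat.Base using (ℕ; zero; suc; _+_; _∸_; _≤_)
open import Data.Product using (Σ; ∃; ∃!; _×_; _,_; proj₁; proj₂)
open import Data.Product.Properties using (Σ-≡,≡→≡)
open import Data.Sum.Base as Sum using (_⊎_; inj₁; inj₂)
open import Data.Vec.Base using (Vec; []; _∷_; lookup)
import Data.Vec.Properties as Vec
open import Function.Base using (_∘_)
open import Function.Bundles using (_⇔_; _↔_; Inverse)
open import Level using (0ℓ)
open import Relation.Binary.Construct.Closure.ReflexiveTransitive using (Star)
open import Relation.Binary.Core using (Rel)
open import Relation.Binary.Definitions
  using (Decidable; DecidableEquality; Symmetric; Irreflexive)
open import Relation.Binary.PropositionalEquality
  using (_≡_; _≢_; refl; sym; trans; cong)
open import Relation.Nullary using (¬_; Dec; yes; no; does)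
open import Relation.Nullary.Decidable
  using (map′; ¬?; _×-dec_; _⊎-dec_; _→-dec_; T?)

-- A finite simple graph; `vertices` lists every vertex exactly once.
record Graph : Set₁ where
  infix 4 _≟_ _~_ _~?_
  field
    V        : Set
    _≟_      : DecidableEquality V
    vertices : List V
    unique   : Unique vertices
    complete : ∀ v → v ∈ vertices
    _~_      : Rel V 0ℓ
    _~?_     : Decidable _~_
    ~-sym    : Symmetric _~_
    ~-irrefl : Irreflexive _≡_ _~_

open Graph using (V)

order : Graph → ℕ
order G = length (Graph.vertices G)

degree : (G : Graph) → V G → ℕ
degree G v = length (filter (v ~?_) vertices)
  where open Graph G

Δ : Graph → ℕ
Δ G = max 0 (List.map (degree G) (Graph.vertices G))

-- An edge is given by an orientation of it; the constructions below that
-- take an edge do not depend on which one.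
record Edge (G : Graph) : Set where
  constructor edge
  field
    {u v}    : V G
    adjacent : Graph._~_ G u v

complement : Graph → Graph
complement G = record
  { Graph G
  ; _~_      = λ x y → x ≢ y × ¬ x ~ y
  ; _~?_     = λ x y → ¬? (x ≟ y) ×-dec ¬? (x ~? y)
  ; ~-sym    = λ (x≢y , x≁y) → x≢y ∘ sym , x≁y ∘ ~-sym
  ; ~-irrefl = λ x≡y (x≢y , _) → x≢y x≡y
  }
  where open Graph G

SamePair : {A : Set} (u v x y : A) → Set
SamePair u v x y = (x ≡ u × y ≡ v) ⊎ (x ≡ v × y ≡ u)

samePair? : {A : Set} → DecidableEquality A → (u v : A) → Decidable (SamePair u v)
samePair? _≟_ u v x y = (x ≟ u ×-dec y ≟ v) ⊎-dec (x ≟ v ×-dec y ≟ u)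

samePair-sym : {A : Set} (u v : A) → Symmetric (SamePair u v)
samePair-sym u v (inj₁ (p , q)) = inj₂ (q , p)
samePair-sym u v (inj₂ (p , q)) = inj₁ (q , p)

infixl 6 _-ₑ_ _+ₑ_ _-ᵥ_

_-ₑ_ : (G : Graph) → Edge G → Graph
G -ₑ edge {u} {v} _ = record
  { Graph G
  ; _~_      = λ x y → x ~ y × ¬ SamePair u v x y
  ; _~?_     = λ x y → (x ~? y) ×-dec ¬? (samePair? _≟_ u v x y)
  ; ~-sym    = λ (x~y , ≠) → ~-sym x~y , ≠ ∘ samePair-sym u v
  ; ~-irrefl = λ x≡y (x~y , _) → ~-irrefl x≡y x~y
  }
  where open Graph G

_+ₑ_ : (G : Graph) → Edge (complement G) → Graph
G +ₑ edge {u} {v} (u≢v , _) = record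
  { Graph G
  ; _~_      = λ x y → x ~ y ⊎ SamePair u v x y
  ; _~?_     = λ x y → (x ~? y) ⊎-dec samePair? _≟_ u v x y
  ; ~-sym    = Sum.map ~-sym (samePair-sym u v)
  ; ~-irrefl = λ where
      x≡y (inj₁ x~y)            → ~-irrefl x≡y x~y
      x≡y (inj₂ (inj₁ (p , q))) → u≢v (trans (sym p) (trans x≡y q))
      x≡y (inj₂ (inj₂ (p , q))) → u≢v (trans (sym q) (trans (sym x≡y) p))
  }
  where open Graph G

module _ {A : Set} (S : A → Bool) where

  restrict : List A → List (Σ A (T ∘ S))
  restrict []       = []
  restrict (x ∷ xs) with T? (S x)
  ... | yes s = (x , s) ∷ restrict xs
  ... | no  _ = restrict xs

  restrict-≡ : {p q : Σ A (T ∘ S)} → proj₁ p ≡ proj₁ q → p ≡ q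
  restrict-≡ eq = Σ-≡,≡→≡ (eq , T-irrelevant _ _)

  restrict-∈ : ∀ {xs} {p : Σ A (T ∘ S)} → proj₁ p ∈ xs → p ∈ restrict xs
  restrict-∈ {x ∷ xs} {p} p∈ with T? (S x) | p∈
  ... | yes s | here eq   = here (restrict-≡ eq)
  ... | yes s | there p∈′ = there (restrict-∈ p∈′)
  ... | no ¬s | here refl = ⊥-elim (¬s (proj₂ p))
  ... | no ¬s | there p∈′ = restrict-∈ p∈′

  restrict-All : ∀ {x xs} {s : T (S x)} → All (x ≢_) xs →
                 All ((x , s) ≢_) (restrict xs)
  restrict-All []                = []
  restrict-All {xs = y ∷ _} (x≢y ∷ x≢) with T? (S y)
  ... | yes _ = (x≢y ∘ cong proj₁) ∷ restrict-All x≢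
  ... | no  _ = restrict-All x≢

  restrict-Unique : ∀ {xs} → Unique xs → Unique (restrict xs)
  restrict-Unique []               = []
  restrict-Unique {x ∷ _} (x≢ ∷ u) with T? (S x)
  ... | yes _ = restrict-All x≢ ∷ restrict-Unique u
  ... | no  _ = restrict-Unique u

-- The subgraph of G induced by the vertex set S.
_[_] : (G : Graph) → (V G → Bool) → Graph
G [ S ] = record
  { V        = Σ (V G) (T ∘ S)
  ; _≟_      = λ p q → map′ (restrict-≡ S) (cong proj₁) (proj₁ p ≟ proj₁ q)
  ; vertices = restrict S vertices
  ; unique   = restrict-Unique S unique
  ; complete = λ p → restrict-∈ S (complete (proj₁ p))
  ; _~_      = λ p q → proj₁ p ~ proj₁ q
  ; _~?_     = λ p q → proj₁ p ~? proj₁ q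
  ; ~-sym    = ~-sym
  ; ~-irrefl = λ p≡q → ~-irrefl (cong proj₁ p≡q)
  }
  where open Graph G using (_≟_; vertices; unique; complete; _~_; _~?_; ~-sym; ~-irrefl)

_-ᵥ_ : (G : Graph) → V G → Graph
G -ᵥ v = G [ (λ x → not (does (x ≟ v))) ]
  where open Graph G

infix 4 _≅_ _⊆ᴵ_

record _≅_ (G H : Graph) : Set where
  open Graph G renaming (_~_ to _~₁_) using ()
  open Graph H renaming (_~_ to _~₂_) using ()
  field
    bijection : V G ↔ V H
  open Inverse bijection public using (to; from)
  field
    preserves : ∀ x y → x ~₁ y ⇔ to x ~₂ to y

_⊆ᴵ_ : Graph → Graph → Set
H ⊆ᴵ G = ∃ λ (S : V G → Bool) → G [ S ] ≅ H

record IsInducedSaturated (H G : Graph) : Set where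
  field
    order≥2 : 2 ≤ order G
    free    : ¬ H ⊆ᴵ G
    remove  : (e : Edge G) → H ⊆ᴵ G -ₑ e
    add     : (e : Edge (complement G)) → H ⊆ᴵ G +ₑ e

Reachable : (G : Graph) → Rel (V G) 0ℓ
Reachable G = Star (Graph._~_ G)

Connected : Graph → Set
Connected G = V G × (∀ x y → Reachable G x y)

-- The cycle visits the distinct vertices x ∷ xs in order and returns to x.
record Cycle (G : Graph) : Set where
  field
    x        : V G
    xs       : List (V G)
    length≥3 : 3 ≤ length (x ∷ xs)
    distinct : Unique (x ∷ xs)
    closed   : Linked (Graph._~_ G) (x ∷ xs ∷ʳ x)

IsTree : Graph → Set
IsTree G = Connected G × ¬ Cycle G

-- (The vertex sets of) components are the reachability classes.
IsComponent : (G : Graph) → (V G → Bool) → Set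
IsComponent G C = ∃ λ w → ∀ x → T (C x) ⇔ Reachable G w x

record 𝒯 (n : ℕ) (G : Graph) : Set where
  field
    tree       : IsTree G
    c          : V G
    c-max      : degree G c ≡ Δ G
    c-unique   : ∀ v → degree G v ≡ Δ G → v ≡ c
    Δ≡n+1      : Δ G ≡ n + 1
    components : ∀ C → IsComponent (G -ᵥ c) C → Δ ((G -ᵥ c) [ C ]) ≤ n ∸ 1

tuples : (n k : ℕ) → List (Vec (Fin k) n)
tuples zero    k = [] ∷ []
tuples (suc n) k = cartesianProductWith _∷_ (allFin k) (tuples n k)

tuples-unique : ∀ n k → Unique (tuples n k)
tuples-unique zero    k = [] ∷ []
tuples-unique (suc n) k =
  Unique.cartesianProductWith⁺ _∷_ Vec.∷-injective (Unique.allFin⁺ k) (tuples-unique n k)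

tuples-complete : ∀ {n k} (x : Vec (Fin k) n) → x ∈ tuples n k
tuples-complete []       = here refl
tuples-complete (i ∷ is) = ∈-cartesianProductWith⁺ _∷_ (∈-allFin i) (tuples-complete is)

DifferInExactlyOne : ∀ {n k} → Rel (Vec (Fin k) n) 0ℓ
DifferInExactlyOne x y = ∃! _≡_ λ i → lookup x i ≢ lookup y i

differInExactlyOne? : ∀ {n k} → Decidable (DifferInExactlyOne {n} {k})
differInExactlyOne? x y = Fin.any? λ i → differ? i ×-dec
  map′ (λ f {j} → f j) (λ f j → f) (Fin.all? λ j → differ? j →-dec (i Fin.≟ j))
  where
  differ? : ∀ i → Dec (lookup x i ≢ lookup y i)
  differ? i = ¬? (lookup x i Fin.≟ lookup y i)

-- The n-fold Cartesian product of cliques of order k.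
□^_K_ : (n k : ℕ) → Graph
□^ n K k = record
  { V        = Vec (Fin k) n
  ; _≟_      = Vec.≡-dec Fin._≟_
  ; vertices = tuples n k
  ; unique   = tuples-unique n k
  ; complete = tuples-complete
  ; _~_      = DifferInExactlyOne
  ; _~?_     = differInExactlyOne?
  ; ~-sym    = λ (i , i≢ , !i) → i , i≢ ∘ sym , λ j≢ → !i (j≢ ∘ sym)
  ; ~-irrefl = λ where refl (i , i≢ , _) → i≢ refl
  }

{-# OPTIONS --safe #-}
module Submission where

-- The neighbourhood of a vertex of □^n K_k is a union of n cliques, so an induced
-- tree has maximum degree at most n.  After an edge uv is altered, n + 1 becomes
-- possible at one vertex: if uv was deleted, u and v are non-adjacent neighbours
-- of a third vertex on their line; if it was added, v is a neighbour of u in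
-- none of the n directions.  From there T is embedded leaf by leaf: a new
-- neighbour of p is placed in a direction unused at p, with a coordinate value
-- that occurs nowhere else, so p is the only embedded vertex adjacent to it.

open import Defs
open import Data.Empty using (⊥-elim)
open import Data.Fin.Base using (Fin; zero; suc) renaming (_<_ to _<ᶠ_)
import Data.Fin.Properties as Fin
open import Data.List.Base as List
  using (List; []; _∷_; _∷ʳ_; length; filter; map)
open import Data.List.Extrema.Nat using (xs≤max)
open import Data.List.Membership.Propositional using (_∈_; _∉_; find; lose)
open import Data.List.Membership.Propositional.Properties
  using (∈-filter⁺; ∈-filter⁻; ∈-lookup; ∈-map⁺; ∈-++⁻)
open import Data.List.Properties using (length-map; length-tabulate)
open import Data.List.Relation.Binary.Subset.Propositional using (_⊆_)
open import Data.List.Relation.Unary.All as All using ([]; _∷_)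
open import Data.List.Relation.Unary.All.Properties using (¬Any⇒All¬; map⁻)
open import Data.List.Relation.Unary.AllPairs using ([]; _∷_)
open import Data.List.Relation.Unary.Any using (here; there; any?)
open import Data.List.Relation.Unary.Linked using (Linked; [-]; _∷_)
open import Data.List.Relation.Unary.Unique.Propositional using (Unique)
import Data.List.Relation.Unary.Unique.Propositional.Properties as Unique
open import Data.Nat.Base using (ℕ; zero; suc; _+_; _≤_; _<_; _≥_; z≤n; s≤s; s≤s⁻¹)
import Data.Nat.Properties as ℕ
open import Data.Product using (∃; ∃₂; _×_; _,_; proj₁; proj₂)
open import Data.Sum.Base using (inj₁; inj₂; [_,_]′)
open import Data.Vec.Base using (Vec; lookup; _[_]≔_; replicate)
import Data.Vec.Properties as Vec
open import Function.Base using (_∘_; id; const)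
open import Function.Bundles using (_⇔_; Inverse; Equivalence; mk⇔; mk↔ₛ′)
open import Level using (0ℓ)
open import Relation.Binary.Construct.Closure.ReflexiveTransitive using (Star; ε; _◅_)
open import Relation.Binary.Core using (Rel)
open import Relation.Binary.Definitions using (Symmetric; Irreflexive)
open import Relation.Binary.PropositionalEquality
  using (_≡_; _≢_; refl; sym; trans; cong; subst; subst₂)
open import Relation.Nullary using (¬_; yes; no)
open import Relation.Nullary.Decidable
  using (¬?; isYes; toWitness; fromWitness; decidable-stable)

open Graph using (V)
open Equivalence using (to; from)

-- Finite lists and counting

private variable
  A : Set

-- Deletes a single occurrence, so that the length drops by exactly one; further copies of `x` may
-- survive in `ys`.
remove : {x : A} {xs : List A} → x ∈ xs →
         ∃ λ ys → length xs ≡ suc (length ys) × (∀ {z} → z ∈ xs → z ≢ x → z ∈ ys)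
remove {xs = x ∷ xs} (here refl) = xs , refl , λ where
  (here refl) z≢x → ⊥-elim (z≢x refl)
  (there z∈)  _   → z∈
remove {xs = x ∷ xs} (there x∈) with remove x∈
... | ys , eq , keep = x ∷ ys , cong suc eq , λ where
  (here refl) _   → here refl
  (there z∈)  z≢x → there (keep z∈ z≢x)

Unique⇒length≤ : {xs ys : List A} → Unique xs → xs ⊆ ys → length xs ≤ length ys
Unique⇒length≤ []      _   = z≤n
Unique⇒length≤ (x≢ ∷ u) xs⊆ys with remove (xs⊆ys (here refl))
... | zs , eq , keep = subst (_ ≤_) (sym eq) (s≤s (Unique⇒length≤ u λ z∈ →
  keep (xs⊆ys (there z∈)) (All.lookup x≢ z∈ ∘ sym)))

Unique⇒lookup-injective : {xs : List A} → Unique xs → ∀ i j →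
                          List.lookup xs i ≡ List.lookup xs j → i ≡ j
Unique⇒lookup-injective (x≢ ∷ u) zero    zero    _  = refl
Unique⇒lookup-injective (x≢ ∷ u) zero    (suc j) eq = ⊥-elim (All.lookup x≢ (∈-lookup j) eq)
Unique⇒lookup-injective (x≢ ∷ u) (suc i) zero    eq = ⊥-elim (All.lookup x≢ (∈-lookup i) (sym eq))
Unique⇒lookup-injective (x≢ ∷ u) (suc i) (suc j) eq = cong suc (Unique⇒lookup-injective u i j eq)

member : {xs : List A} → 1 ≤ length xs → ∃ (_∈ xs)
member {xs = x ∷ _} _ = x , here refl

two-members : {xs : List A} → Unique xs → 2 ≤ length xs → ∃₂ λ x y → x ≢ y × x ∈ xs × y ∈ xs
two-members ((x≢y ∷ _) ∷ _) (s≤s (s≤s _)) = _ , _ , x≢y , here refl , there (here refl)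

absent : ∀ {m} (xs : List (Fin m)) → length xs < m → ∃ λ a → a ∉ xs
absent {m} xs xs<m with Fin.any? (λ a → ¬? (any? (a Fin.≟_) xs))
... | yes found = found
... | no ¬found = ⊥-elim (ℕ.<⇒≱ xs<m (subst (_≤ length xs) (length-tabulate id)
  (Unique⇒length≤ (Unique.allFin⁺ m) λ {a} _ →
    decidable-stable (any? (a Fin.≟_) xs) (¬found ∘ (a ,_)))))

-- Directions and lines in the product of cliques

module _ {n k : ℕ} where

  private variable
    i j   : Fin n
    x y z : Vec (Fin k) n

  record DiffersAt (i : Fin n) (x y : Vec (Fin k) n) : Set where
    constructor differs
    field
      here≢ : lookup x i ≢ lookup y i
      only  : ∀ {j} → lookup x j ≢ lookup y j → i ≡ j

  -- Being on a common line in direction `i`. Equality of `x` and `y` is allowed, which makes this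
  -- relation transitive, unlike `DiffersAt i`.
  record AgreeOff (i : Fin n) (x y : Vec (Fin k) n) : Set where
    constructor agree
    field off : ∀ j → j ≢ i → lookup x j ≡ lookup y j

  open DiffersAt public
  open AgreeOff public

  adjacent⇒differsAt : DifferInExactlyOne x y → ∃ λ i → DiffersAt i x y
  adjacent⇒differsAt (i , ≢ , !i) = i , differs ≢ !i

  differsAt⇒adjacent : DiffersAt i x y → DifferInExactlyOne x y
  differsAt⇒adjacent (differs ≢ !i) = _ , ≢ , !i

  differsAt-sym : DiffersAt i x y → DiffersAt i y x
  differsAt-sym (differs ≢ !i) = differs (≢ ∘ sym) λ ≢′ → !i (≢′ ∘ sym)

  agreeOff-sym : AgreeOff i x y → AgreeOff i y x
  agreeOff-sym (agree p) = agree λ j j≢i → sym (p j j≢i)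

  agreeOff-trans : AgreeOff i x y → AgreeOff i y z → AgreeOff i x z
  agreeOff-trans (agree p) (agree q) = agree λ j j≢i → trans (p j j≢i) (q j j≢i)

  differsAt⇒agreeOff : DiffersAt i x y → AgreeOff i x y
  differsAt⇒agreeOff (differs _ !i) = agree λ j j≢i →
    decidable-stable (_ Fin.≟ _) λ ≢ → j≢i (sym (!i ≢))

  agreeOff⇒differsAt : AgreeOff i x y → x ≢ y → DiffersAt i x y
  agreeOff⇒differsAt {i} {x} {y} (agree p) x≢y = differs
    (λ eq → x≢y (lookup-ext (agree-everywhere eq)))
    λ {j} ≢ → decidable-stable (i Fin.≟ j) λ i≢j → ≢ (p j (i≢j ∘ sym))
    where
    agree-everywhere : lookup x i ≡ lookup y i → ∀ j → lookup x j ≡ lookup y j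
    agree-everywhere eq j with j Fin.≟ i
    ... | yes refl = eq
    ... | no  j≢i  = p j j≢i
    lookup-ext : (∀ j → lookup x j ≡ lookup y j) → x ≡ y
    lookup-ext eq = trans (sym (Vec.tabulate∘lookup x))
                          (trans (Vec.tabulate-cong eq) (Vec.tabulate∘lookup y))

  direction-unique : AgreeOff j x y → DiffersAt i x y → i ≡ j
  direction-unique {j} {i = i} (agree p) (differs ≢ _) =
    decidable-stable (i Fin.≟ j) (≢ ∘ p i)

  agreeOff-[]≔ : ∀ (x : Vec (Fin k) n) j a → AgreeOff j (x [ j ]≔ a) x
  agreeOff-[]≔ x j a = agree λ _ i≢j → Vec.lookup∘update′ i≢j x a

-- Neighbourhoods and degrees

neighbours : (G : Graph) → V G → List (V G)
neighbours G v = filter (v ~?_) vertices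
  where open Graph G

module _ (G : Graph) where

  open Graph G hiding (V)

  ∈-neighbours⁺ : ∀ {x y} → x ~ y → y ∈ neighbours G x
  ∈-neighbours⁺ {x} {y} = ∈-filter⁺ (x ~?_) (complete y)

  ∈-neighbours⁻ : ∀ {x y} → y ∈ neighbours G x → x ~ y
  ∈-neighbours⁻ {x} y∈ = proj₂ (∈-filter⁻ (x ~?_) {xs = vertices} y∈)

  neighbours-unique : ∀ x → Unique (neighbours G x)
  neighbours-unique x = Unique.filter⁺ (x ~?_) unique

  -- Counts the neighbours of `x` still to be embedded once its neighbour `p` has been.
  others : ∀ {x p} → x ~ p → ∃ λ R → (∀ {z} → x ~ z → z ≢ p → z ∈ R) × degree G x ≡ suc (length R)
  others x~p with remove (∈-neighbours⁺ x~p)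
  ... | R , eq , keep = R , keep ∘ ∈-neighbours⁺ , eq

  degree≤Δ : ∀ x → degree G x ≤ Δ G
  degree≤Δ x = All.lookup (map⁻ (xs≤max 0 (map (degree G) vertices))) (complete x)

  ≢⇒order≥2 : ∀ {x y} → x ≢ y → 2 ≤ order G
  ≢⇒order≥2 x≢y = Unique⇒length≤ ((x≢y ∷ []) ∷ [] ∷ []) λ {z} _ → complete z

  triangle-free : ¬ Cycle G → ∀ {x y z} → x ~ y → x ~ z → ¬ y ~ z
  triangle-free acyclic x~y x~z y~z = acyclic record
    { length≥3 = s≤s (s≤s (s≤s z≤n))
    ; distinct = ((λ eq → ~-irrefl eq x~y) ∷ (λ eq → ~-irrefl eq x~z) ∷ []) ∷
                 ((λ eq → ~-irrefl eq y~z) ∷ []) ∷ [] ∷ []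
    ; closed   = x~y ∷ y~z ∷ ~-sym x~z ∷ [-]
    }

-- Induced subgraphs as embeddings

module _ {H G : Graph} where

  open Graph H using () renaming (_~_ to _~₁_)
  open Graph G using () renaming (_~_ to _~₂_)

  -- The inducing set is the image of `f`, decided by a search through the vertices of `H`; by
  -- injectivity the same search inverts `f`.
  embedding⇒⊆ᴵ : (f : V H → V G) → (∀ {x y} → f x ≡ f y → x ≡ y) →
                 (∀ x y → x ~₁ y ⇔ f x ~₂ f y) → H ⊆ᴵ G
  embedding⇒⊆ᴵ f inj pres = S , record
    { bijection = mk↔ₛ′ (proj₁ ∘ preimage)
                        (λ x → f x , fromWitness (lose (Graph.complete H x) refl))
                        (λ x → inj (proj₂ (preimage _)))
                        (λ p → restrict-≡ S (proj₂ (preimage p)))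
    ; preserves = λ p q → mk⇔
        (from (pres _ _) ∘ subst₂ _~₂_ (sym (proj₂ (preimage p))) (sym (proj₂ (preimage q))))
        (subst₂ _~₂_ (proj₂ (preimage p)) (proj₂ (preimage q)) ∘ to (pres _ _))
    }
    where
    S = λ y → isYes (any? (λ x → Graph._≟_ G (f x) y) (Graph.vertices H))
    preimage : (p : V (G [ S ])) → ∃ λ x → f x ≡ proj₁ p
    preimage (y , s) with find (toWitness s)
    ... | x , _ , eq = x , eq

  ⊆ᴵ⇒embedding : H ⊆ᴵ G → ∃ λ (f : V H → V G) →
                 (∀ {x y} → f x ≡ f y → x ≡ y) × (∀ x y → x ~₁ y ⇔ f x ~₂ f y)
  ⊆ᴵ⇒embedding (S , iso) = f , inj , λ x y → mk⇔
    (λ x~y → from (preserves _ _) (subst₂ _~₁_ (sym (inverseˡ x)) (sym (inverseˡ y)) x~y))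
    (λ fx~fy → subst₂ _~₁_ (inverseˡ x) (inverseˡ y) (to (preserves _ _) fx~fy))
    where
    open _≅_ iso using (bijection; preserves) renaming (to to φ; from to ψ)
    f = proj₁ ∘ ψ
    inverseˡ : ∀ x → φ (ψ x) ≡ x
    inverseˡ = Inverse.strictlyInverseˡ bijection
    inj : ∀ {x y} → f x ≡ f y → x ≡ y
    inj {x} {y} eq = trans (sym (inverseˡ x)) (trans (cong φ (restrict-≡ S eq)) (inverseˡ y))

-- Freeness of the product

-- Two of n + 1 neighbours of a vertex lie in the same direction from it,
-- so they are adjacent.
degree>n⇒⊈□ : ∀ {n k} (H : Graph) → ¬ Cycle H → ∀ c → n < degree H c → ¬ H ⊆ᴵ □^ n K k
degree>n⇒⊈□ {n} {k} H acyclic c n<deg H⊆ with ⊆ᴵ⇒embedding {H} {□^ n K k} H⊆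
... | f , inj , pres = clash (Fin.pigeonhole n<deg (λ i → proj₁ (edgeTo i)))
  where
  N = neighbours H c
  edgeTo : (i : Fin (length N)) → ∃ λ d → DiffersAt d (f c) (f (List.lookup N i))
  edgeTo i = adjacent⇒differsAt (to (pres _ _) (∈-neighbours⁻ H (∈-lookup i)))
  clash : ¬ (∃₂ λ i j → i <ᶠ j × proj₁ (edgeTo i) ≡ proj₁ (edgeTo j))
  clash (i , j , i<j , eq) = triangle-free H acyclic
    (∈-neighbours⁻ H (∈-lookup i)) (∈-neighbours⁻ H (∈-lookup j))
    (from (pres _ _) (differsAt⇒adjacent (agreeOff⇒differsAt
      (agreeOff-trans
        (agreeOff-sym (differsAt⇒agreeOff (subst (λ d → DiffersAt d _ _) eq (proj₂ (edgeTo i)))))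
        (differsAt⇒agreeOff (proj₂ (edgeTo j))))
      λ same → Fin.<⇒≢ i<j (Unique⇒lookup-injective (neighbours-unique H c) i j (inj same)))))

-- Simple paths and trees grown leaf by leaf

module _ (G : Graph) where

  open Graph G hiding (V)

  data Path : V G → V G → List (V G) → Set where
    [_] : ∀ x → Path x x (x ∷ [])
    _∷_ : ∀ {x y z ps} → x ~ y × x ∉ ps → Path y z ps → Path x z (x ∷ ps)

  -- Certifies that the vertices of the list, newest first, induce a connected subgraph. That `p` is
  -- the only earlier neighbour of `x` is not demanded here; acyclicity gives it in `attached-once`.
  data Grown : List (V G) → Set where
    root : ∀ c → Grown (c ∷ [])
    grow : ∀ {L p x} → Grown L → p ∈ L → x ∉ L → x ~ p → Grown (x ∷ L)

module _ {G : Graph} where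

  open Graph G hiding (V)

  private variable
    x y z p q : V G
    ps L      : List (V G)

  path-∷ʳ : Path G x y ps → y ~ z → z ∉ ps → Path G x z (ps ∷ʳ z)
  path-∷ʳ [ x ] y~z z∉ = (y~z , λ where (here refl) → z∉ (here refl)) ∷ [ _ ]
  path-∷ʳ (_∷_ {ps = ps} (x~y , x∉) path) y~z z∉ =
    (x~y , λ x∈ → [ x∉ , (λ where (here refl) → z∉ (here refl)) ]′ (∈-++⁻ ps x∈))
    ∷ path-∷ʳ path y~z (z∉ ∘ there)

  path-unique : Path G x y ps → Unique ps
  path-unique [ x ]             = [] ∷ []
  path-unique ((_ , x∉) ∷ path) = ¬Any⇒All¬ _ x∉ ∷ path-unique path

  path-length : x ≢ y → Path G x y ps → 2 ≤ length ps
  path-length x≢y [ x ]       = ⊥-elim (x≢y refl)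
  path-length _   (_ ∷ [ _ ]) = s≤s (s≤s z≤n)
  path-length _   (_ ∷ _ ∷ _) = s≤s (s≤s z≤n)

  path-linked : x ~ y → Path G y z ps → z ~ p → Linked _~_ (x ∷ ps ∷ʳ p)
  path-linked x~y [ _ ]              z~p = x~y ∷ z~p ∷ [-]
  path-linked x~y ((y~w , _) ∷ path) z~p = x~y ∷ path-linked y~w path z~p

  -- A path to or from the newest vertex goes through its attachment point. Staying inside `L` keeps
  -- it simple when a vertex outside `L` is added.
  grown-path : Grown G L → x ∈ L → y ∈ L → ∃ λ ps → Path G x y ps × ps ⊆ L
  grown-path (root c) (here refl) (here refl) = _ , [ c ] , id
  grown-path (grow g p∈ x∉ x~p) (here refl) (here refl) =
    _ , [ _ ] , λ where (here refl) → here refl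
  grown-path (grow g p∈ x∉ x~p) (here refl) (there y∈) with grown-path g p∈ y∈
  ... | _ , path , ps⊆ = _ , (x~p , x∉ ∘ ps⊆) ∷ path , λ where
    (here eq)  → here eq
    (there z∈) → there (ps⊆ z∈)
  grown-path (grow g p∈ x∉ x~p) (there y∈) (here refl) with grown-path g y∈ p∈
  ... | ps , path , ps⊆ = _ , path-∷ʳ path (~-sym x~p) (x∉ ∘ ps⊆) , λ z∈ →
    [ there ∘ ps⊆ , (λ where (here eq) → here eq) ]′ (∈-++⁻ ps z∈)
  grown-path (grow g _ _ _) (there x∈) (there y∈) with grown-path g x∈ y∈
  ... | _ , path , ps⊆ = _ , path , there ∘ ps⊆

  grown-unique : Grown G L → Unique L
  grown-unique (root c)        = [] ∷ []
  grown-unique (grow g _ x∉ _) = ¬Any⇒All¬ _ x∉ ∷ grown-unique g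

  grown-nonempty : Grown G L → ∃ (_∈ L)
  grown-nonempty (root c)       = c , here refl
  grown-nonempty (grow g _ _ _) = _ , here refl

  -- If `q` differed from `p`, a path between them inside `L` would close up through `x` to a cycle.
  attached-once : ¬ Cycle G → Grown G L → x ∉ L → p ∈ L → q ∈ L → x ~ p → x ~ q → q ≡ p
  attached-once {x = x} {p} {q} acyclic g x∉ p∈ q∈ x~p x~q with q ≟ p | grown-path g p∈ q∈
  ... | yes q≡p | _ = q≡p
  ... | no  q≢p | ps , path , ps⊆ = ⊥-elim (acyclic record
    { x        = x
    ; xs       = ps
    ; length≥3 = s≤s (path-length (q≢p ∘ sym) path)
    ; distinct = ¬Any⇒All¬ _ (x∉ ∘ ps⊆) ∷ path-unique path
    ; closed   = path-linked x~p path (~-sym x~q)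
    })

-- Partial embeddings

module _ {B : Set} (G : Graph) where

  open Graph G hiding (V)

  update : V G → B → (V G → B) → V G → B
  update x b f y with y ≟ x
  ... | yes _ = b
  ... | no  _ = f y

  update-≡ : ∀ x b f → update x b f x ≡ b
  update-≡ x b f with x ≟ x
  ... | yes _  = refl
  ... | no x≢x = ⊥-elim (x≢x refl)

  update-≢ : ∀ {x y b f} → y ≢ x → update x b f y ≡ f y
  update-≢ {x} {y} y≢x with y ≟ x
  ... | yes y≡x = ⊥-elim (y≢x y≡x)
  ... | no _    = refl

  update-∈ : ∀ {x y b f L} → x ∉ L → y ∈ L → update x b f y ≡ f y
  update-∈ x∉ y∈ = update-≢ λ where refl → x∉ y∈

  module _ (_≈_ : Rel B 0ℓ) where

    -- The map is total for convenience; its values outside `L` are arbitrary.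
    record PartialEmbedding (L : List (V G)) (f : V G → B) : Set where
      field
        preserves : ∀ {x y} → x ∈ L → y ∈ L → x ~ y ⇔ f x ≈ f y
        injective : ∀ {x y} → x ∈ L → y ∈ L → f x ≡ f y → x ≡ y

    module _ (≈-sym : Symmetric _≈_) (≈-irrefl : Irreflexive _≡_ _≈_) where

      singleton : ∀ x f → PartialEmbedding (x ∷ []) f
      singleton x f = record
        { preserves = λ where
            (here refl) (here refl) → mk⇔ (⊥-elim ∘ ~-irrefl refl) (⊥-elim ∘ ≈-irrefl refl)
        ; injective = λ where (here refl) (here refl) _ → refl
        }

      extend : ∀ {L f x b} → PartialEmbedding L f → x ∉ L →
               (∀ {y} → y ∈ L → x ~ y ⇔ b ≈ f y) → (∀ {y} → y ∈ L → b ≢ f y) →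
               PartialEmbedding (x ∷ L) (update x b f)
      extend {L} {f} {x} {b} emb x∉ x~⇔ b≢ = record { preserves = pres ; injective = inj }
        where
        open PartialEmbedding emb
        g = update x b f
        pres : ∀ {y z} → y ∈ x ∷ L → z ∈ x ∷ L → y ~ z ⇔ g y ≈ g z
        pres (here refl) (here refl) = mk⇔ (⊥-elim ∘ ~-irrefl refl) (⊥-elim ∘ ≈-irrefl refl)
        pres (here refl) (there z∈)
          rewrite update-≡ x b f | update-∈ {b = b} {f} x∉ z∈ = x~⇔ z∈
        pres (there y∈) (here refl)
          rewrite update-≡ x b f | update-∈ {b = b} {f} x∉ y∈ =
          mk⇔ (≈-sym ∘ to (x~⇔ y∈) ∘ ~-sym) (~-sym ∘ from (x~⇔ y∈) ∘ ≈-sym)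
        pres (there y∈) (there z∈)
          rewrite update-∈ {b = b} {f} x∉ y∈ | update-∈ {b = b} {f} x∉ z∈ = preserves y∈ z∈
        inj : ∀ {y z} → y ∈ x ∷ L → z ∈ x ∷ L → g y ≡ g z → y ≡ z
        inj (here refl) (here refl) _ = refl
        inj (here refl) (there z∈) eq
          rewrite update-≡ x b f | update-∈ {b = b} {f} x∉ z∈ = ⊥-elim (b≢ z∈ eq)
        inj (there y∈) (here refl) eq
          rewrite update-≡ x b f | update-∈ {b = b} {f} x∉ y∈ = ⊥-elim (b≢ y∈ (sym eq))
        inj (there y∈) (there z∈) eq
          rewrite update-∈ {b = b} {f} x∉ y∈ | update-∈ {b = b} {f} x∉ z∈ = injective y∈ z∈ eq

-- Greedy extension to the whole tree

-- _≈_ is the adjacency of □^n K_k after adding or deleting the edge uv.  The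
-- bound on k leaves a value for each coordinate that occurs neither in u, in v
-- nor in the image of a partial embedding.
module Growth
  {n k : ℕ} (T : Graph) (connected : Connected T) (acyclic : ¬ Cycle T) (T<k : 2 + order T < k)
  (_≈_ : Rel (Vec (Fin k) n) 0ℓ) (≈-sym : Symmetric _≈_) (≈-irrefl : Irreflexive _≡_ _≈_)
  (u v : Vec (Fin k) n)
  (unaltered : ∀ {x y} → x ≢ u → x ≢ v → x ≈ y ⇔ DifferInExactlyOne x y)
  where

  open Graph T hiding (V)

  -- ds contains the directions in use at f y, and R the neighbours of y that
  -- are still to be embedded; each of them will need a direction of its own.
  Slack : List (V T) → (V T → Vec (Fin k) n) → V T → Set
  Slack L f y = ∃₂ λ (ds : List (Fin n)) (R : List (V T)) →
    (∀ {z i} → z ∈ L → DiffersAt i (f y) (f z) → i ∈ ds) ×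
    (∀ {z} → y ~ z → z ∉ L → z ∈ R) ×
    length ds + length R ≤ n

  -- The invariant of the growth. A vertex that enters later needs a separate direction for each of
  -- its neighbours, hence `small`; a vertex of degree `n + 1` must therefore be in `L` from the
  -- start.
  record Stage (L : List (V T)) (f : V T → Vec (Fin k) n) : Set where
    field
      grown     : Grown T L
      embedding : PartialEmbedding T _≈_ L f
      slack     : ∀ {y} → y ∈ L → Slack L f y
      small     : ∀ {y} → y ∉ L → degree T y ≤ n

  module _ {L f p x} (s : Stage L f) (p∈ : p ∈ L) (x∉ : x ∉ L) (x~p : x ~ p) where

    open Stage s
    open PartialEmbedding embedding

    private
      ds = proj₁ (slack p∈)
      R  = proj₁ (proj₂ (slack p∈))
      used : ∀ {z i} → z ∈ L → DiffersAt i (f p) (f z) → i ∈ ds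
      used = proj₁ (proj₂ (proj₂ (slack p∈)))
      pending : ∀ {z} → p ~ z → z ∉ L → z ∈ R
      pending = proj₁ (proj₂ (proj₂ (proj₂ (slack p∈))))

      shrink = remove (pending (~-sym x~p) x∉)
      R′ = proj₁ shrink

      ds+1+R′≤n : suc (length ds + length R′) ≤ n
      ds+1+R′≤n = subst (_≤ n)
        (trans (cong (length ds +_) (proj₁ (proj₂ shrink))) (ℕ.+-suc _ _))
        (proj₂ (proj₂ (proj₂ (proj₂ (slack p∈)))))

      -- Since `x` is itself pending at `p`, the slack leaves fewer than `n` directions in `ds`.
      free-direction = absent ds (ℕ.≤-trans (s≤s (ℕ.m≤m+n _ _)) ds+1+R′≤n)
      j  = proj₁ free-direction
      j∉ = proj₂ free-direction

      -- Avoiding the entries of `u` and `v` keeps the new point off the altered edge, so that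
      -- `unaltered` applies to it. At most `2 + order T` values are excluded.
      taken : List (Fin k)
      taken = lookup u j ∷ lookup v j ∷ map (λ y → lookup (f y) j) L

      fresh-value = absent taken (ℕ.≤-<-trans
        (s≤s (s≤s (ℕ.≤-trans (ℕ.≤-reflexive (length-map _ L))
                             (Unique⇒length≤ (grown-unique grown) λ {z} _ → complete z))))
        T<k)
      a  = proj₁ fresh-value
      a∉ = proj₂ fresh-value

      b = f p [ j ]≔ a

      b≢ : ∀ {z} → lookup z j ∈ taken → b ≢ z
      b≢ z∈ refl = a∉ (subst (_∈ taken) (Vec.lookup∘update j (f p) a) z∈)

      b≢f : ∀ {y} → y ∈ L → b ≢ f y
      b≢f y∈ = b≢ (there (there (∈-map⁺ (λ y → lookup (f y) j) y∈)))

      -- The fresh value already makes `b` differ from every embedded point in coordinate `j`.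
      differs-at-j : ∀ {y i} → y ∈ L → DiffersAt i b (f y) → i ≡ j
      differs-at-j y∈ d = only d λ eq →
        a∉ (subst (_∈ taken) (trans (sym eq) (Vec.lookup∘update j (f p) a))
                  (there (there (∈-map⁺ (λ y → lookup (f y) j) y∈))))

      -- Both `f p` and `f y` lie on the line through `b` in direction `j`. If they were distinct,
      -- `j` would be in use at `f p`, contrary to its choice.
      only-p : ∀ {y i} → y ∈ L → DiffersAt i b (f y) → y ≡ p
      only-p {y} y∈ d with differs-at-j y∈ d | y ≟ p
      ... | refl | yes y≡p = y≡p
      ... | refl | no  y≢p = ⊥-elim (j∉ (used y∈ (agreeOff⇒differsAt
        (agreeOff-trans (agreeOff-sym (agreeOff-[]≔ (f p) j a)) (differsAt⇒agreeOff d))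
        (y≢p ∘ sym ∘ injective p∈ y∈))))

      x~⇔ : ∀ {y} → y ∈ L → x ~ y ⇔ b ≈ f y
      x~⇔ {y} y∈ = mk⇔
        (λ x~y → from altered (subst (DifferInExactlyOne b ∘ f)
          (sym (attached-once acyclic grown x∉ p∈ y∈ x~p x~y))
          (differsAt⇒adjacent (agreeOff⇒differsAt (agreeOff-[]≔ (f p) j a) (b≢f p∈)))))
        (λ b≈ → subst (x ~_) (sym (only-p y∈ (proj₂ (adjacent⇒differsAt (to altered b≈))))) x~p)
        where altered = unaltered (b≢ (here refl)) (b≢ (there (here refl)))

      g = update T x b f

      g-x : g x ≡ b
      g-x = update-≡ T x b f

      g-∈ : ∀ {y} → y ∈ L → g y ≡ f y
      g-∈ = update-∈ T x∉

      -- One direction is in use at `x`, and all its neighbours but `p` may be pending: together at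
      -- most `degree T x`, which `small` bounds by `n`.
      slack-x : Slack (x ∷ L) g x
      slack-x with others T x~p
      ... | R₀ , pending₀ , eq = j ∷ [] , R₀
        , (λ where
            (here refl) d → ⊥-elim (here≢ d refl)
            (there z∈)  d →
              here (differs-at-j z∈ (subst₂ (DiffersAt _) g-x (g-∈ z∈) d)))
        , (λ x~z z∉ → pending₀ x~z λ where refl → z∉ (there p∈))
        , subst (_≤ n) eq (small x∉)

      -- At `p` the direction `j` becomes used while `x` stops being pending, so the sum is
      -- unchanged. At any other vertex the new point uses no direction, by `only-p`.
      slack-∈ : ∀ {y} → y ∈ L → Slack (x ∷ L) g y
      slack-∈ {y} y∈ with y ≟ p
      ... | yes refl = j ∷ ds , R′
        , (λ where
            (here refl) d → here (differs-at-j p∈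
                                   (subst₂ (DiffersAt _) g-x (g-∈ p∈) (differsAt-sym d)))
            (there z∈)  d → there (used z∈ (subst₂ (DiffersAt _) (g-∈ p∈) (g-∈ z∈) d)))
        , (λ p~z z∉ → proj₂ (proj₂ shrink) (pending p~z (z∉ ∘ there)) (z∉ ∘ here))
        , ds+1+R′≤n
      ... | no y≢p with slack y∈
      ...   | ds₀ , R₀ , used₀ , pending₀ , ≤n = ds₀ , R₀
        , (λ where
            (here refl) d → ⊥-elim (y≢p (only-p y∈
                              (subst₂ (DiffersAt _) g-x (g-∈ y∈) (differsAt-sym d))))
            (there z∈)  d → used₀ z∈ (subst₂ (DiffersAt _) (g-∈ y∈) (g-∈ z∈) d))
        , (λ y~z z∉ → pending₀ y~z (z∉ ∘ there))
        , ≤n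

    attach : ∃ (Stage (x ∷ L))
    attach = g , record
      { grown     = grow grown p∈ x∉ x~p
      ; embedding = extend T _≈_ ≈-sym ≈-irrefl embedding x∉ x~⇔ b≢f
      ; slack     = λ where
          (here refl) → slack-x
          (there y∈)  → slack-∈ y∈
      ; small     = λ y∉ → small (y∉ ∘ there)
      }

  -- Follows the walk and attaches each vertex not yet embedded to its predecessor.
  reach : ∀ {L f y z} → Stage L f → y ∈ L → Reachable T y z →
          ∃₂ λ L′ f′ → Stage L′ f′ × L ⊆ L′ × z ∈ L′
  reach s y∈ ε = _ , _ , s , id , y∈
  reach {L} s y∈ (_◅_ {j = w} y~w walk) with any? (w ≟_) L
  ... | yes w∈ = reach s w∈ walk
  ... | no  w∉ with reach (proj₂ (attach s y∈ w∉ (~-sym y~w))) (here refl) walk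
  ...   | L′ , f′ , s′ , L⊆ , z∈ = L′ , f′ , s′ , L⊆ ∘ there , z∈

  cover : ∀ {L f} → Stage L f → ∀ xs → ∃₂ λ L′ f′ → Stage L′ f′ × xs ⊆ L′
  cover s []       = _ , _ , s , λ ()
  cover s (x ∷ xs) with cover s xs
  ... | _ , _ , s₁ , xs⊆ with grown-nonempty (Stage.grown s₁)
  ...   | y , y∈ with reach s₁ y∈ (proj₂ connected y x)
  ...     | _ , _ , s₂ , L⊆ , x∈ = _ , _ , s₂ , λ where
    (here refl) → x∈
    (there z∈)  → L⊆ (xs⊆ z∈)

  total : ∀ {L f} → Stage L f → ∃ λ (g : V T → Vec (Fin k) n) →
          (∀ {x y} → g x ≡ g y → x ≡ y) × (∀ x y → x ~ y ⇔ g x ≈ g y)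
  total s with cover s vertices
  ... | _ , g , s′ , all = g
    , (λ {x} {y} → injective (all (complete x)) (all (complete y)))
    , (λ x y → preserves (all (complete x)) (all (complete y)))
    where open PartialEmbedding (Stage.embedding s′)

-- Initial embeddings around the altered edge

module Saturation
  {n : ℕ} (T : Graph) (connected : Connected T) (acyclic : ¬ Cycle T)
  (c : V T) (degree-c : degree T c ≡ suc n) (degree-≢c : ∀ {y} → y ≢ c → degree T y ≤ n)
  where

  open Graph T hiding (V)

  -- The least value that the bound in `Growth` admits; it also guarantees a third point on every
  -- line.
  k = 3 + order T

  private
    ~⇒≢c : ∀ {y} → y ~ c → y ≢ c
    ~⇒≢c y~c y≡c = ~-irrefl y≡c y~c

  -- The vertex `c` goes to a third point `w` of the line through `u` and `v`, and two of its
  -- neighbours go to `u` and `v`. These two share one direction from `w`, so `n` directions suffice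
  -- for `n + 1` neighbours.
  remove-edge : 1 ≤ n → (e : Edge (□^ n K k)) → T ⊆ᴵ □^ n K k -ₑ e
  remove-edge 1≤n e@(edge {u} {v} u~v) =
    embedding⇒⊆ᴵ {T} {G} (proj₁ result) (proj₁ (proj₂ result)) (proj₂ (proj₂ result))
    where
    G = □^ n K k -ₑ e
    open Graph G using () renaming (_~_ to _≈_; ~-sym to ≈-sym; ~-irrefl to ≈-irrefl)
    open Growth {n} {k} T connected acyclic ℕ.≤-refl _≈_ ≈-sym ≈-irrefl u v
      (λ x≢u x≢v → mk⇔ proj₁ λ d → d , [ x≢u ∘ proj₁ , x≢v ∘ proj₁ ]′)

    i   = proj₁ (adjacent⇒differsAt {x = u} {v} u~v)
    u-v = proj₂ (adjacent⇒differsAt {x = u} {v} u~v)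

    taken : List (Fin k)
    taken = lookup u i ∷ lookup v i ∷ []

    third : ∃ (_∉ taken)
    third = absent taken (s≤s (s≤s (s≤s z≤n)))

    w = u [ i ]≔ proj₁ third

    w≢ : ∀ {x} → lookup x i ∈ taken → w ≢ x
    w≢ x∈ refl = proj₂ third (subst (_∈ taken) (Vec.lookup∘update i u _) x∈)

    w≢u = w≢ (here refl)
    w≢v = w≢ (there (here refl))

    w-off-u : AgreeOff i w u
    w-off-u = agreeOff-[]≔ u i _

    w≈u : w ≈ u
    w≈u = differsAt⇒adjacent (agreeOff⇒differsAt w-off-u w≢u) , [ w≢u ∘ proj₁ , w≢v ∘ proj₁ ]′

    w≈v : w ≈ v
    w≈v = differsAt⇒adjacent (agreeOff⇒differsAt
            (agreeOff-trans w-off-u (differsAt⇒agreeOff u-v)) w≢v)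
        , [ w≢u ∘ proj₁ , w≢v ∘ proj₁ ]′

    picked = two-members (neighbours-unique T c)
      (subst (2 ≤_) (sym degree-c) (s≤s 1≤n))
    a   = proj₁ picked
    b   = proj₁ (proj₂ picked)
    a≢b = proj₁ (proj₂ (proj₂ picked))
    c~a = ∈-neighbours⁻ T (proj₁ (proj₂ (proj₂ (proj₂ picked))))
    c~b = ∈-neighbours⁻ T (proj₂ (proj₂ (proj₂ (proj₂ picked))))

    a∉ : a ∉ c ∷ []
    a∉ (here eq) = ~⇒≢c (~-sym c~a) eq

    b∉ : b ∉ a ∷ c ∷ []
    b∉ (here eq)         = a≢b (sym eq)
    b∉ (there (here eq)) = ~⇒≢c (~-sym c~b) eq

    f₀ f₁ f₂ : V T → V G
    f₀ = const w
    f₁ = update T a u f₀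
    f₂ = update T b v f₁

    f₁a : f₁ a ≡ u
    f₁a = update-≡ T a u f₀
    f₁c : f₁ c ≡ w
    f₁c = update-∈ T a∉ (here refl)

    emb₁ : PartialEmbedding T _≈_ (a ∷ c ∷ []) f₁
    emb₁ = extend T _≈_ ≈-sym ≈-irrefl (singleton T _≈_ ≈-sym ≈-irrefl c f₀) a∉
      (λ where (here refl) → mk⇔ (λ _ → ≈-sym w≈u) (λ _ → ~-sym c~a))
      (λ where (here refl) → w≢u ∘ sym)

    emb₂ : PartialEmbedding T _≈_ (b ∷ a ∷ c ∷ []) f₂
    emb₂ = extend T _≈_ ≈-sym ≈-irrefl emb₁ b∉
      (λ where
        -- Neither side holds: `a` and `b` have the common neighbour `c` in a tree, and `v`, `u` is
        -- the deleted pair.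
        (here refl)         → mk⇔
          (⊥-elim ∘ triangle-free T acyclic c~b c~a)
          (λ v≈ → ⊥-elim (proj₂ (subst (v ≈_) f₁a v≈) (inj₂ (refl , refl))))
        (there (here refl)) → mk⇔ (λ _ → subst (v ≈_) (sym f₁c) (≈-sym w≈v)) (λ _ → ~-sym c~b))
      (λ where
        (here refl)         v≡ → here≢ u-v (cong (λ x → lookup x i) (sym (trans v≡ f₁a)))
        (there (here refl)) v≡ → w≢v (sym (trans v≡ f₁c)))

    -- Hence `i` is the only direction in use among the three initial points.
    collinear : ∀ {y} → y ∈ b ∷ a ∷ c ∷ [] → AgreeOff i (f₂ y) u
    collinear (here refl) = subst (λ x → AgreeOff i x u) (sym (update-≡ T b v f₁))
      (agreeOff-sym (differsAt⇒agreeOff u-v))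
    collinear (there y∈@(here refl)) = subst (λ x → AgreeOff i x u)
      (sym (trans (update-∈ T b∉ y∈) f₁a)) (agree λ _ _ → refl)
    collinear (there y∈@(there (here refl))) = subst (λ x → AgreeOff i x u)
      (sym (trans (update-∈ T b∉ y∈) f₁c)) w-off-u

    -- The successor accounts for the direction `i`. At `c` exactly `n - 1` neighbours remain after
    -- `a` and `b`; at `a` and `b` the neighbour `c` is discounted from a degree of at most `n`.
    unseen : ∀ {y} → y ∈ b ∷ a ∷ c ∷ [] → ∃ λ R →
             (∀ {z} → y ~ z → z ∉ b ∷ a ∷ c ∷ [] → z ∈ R) × suc (length R) ≤ n
    unseen (there (there (here refl))) with others T c~a
    ... | R , pending , eq with remove (pending c~b (a≢b ∘ sym))
    ...   | R′ , eq′ , keep = R′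
      , (λ c~z z∉ → keep (pending c~z (z∉ ∘ there ∘ here)) (z∉ ∘ here))
      , ℕ.≤-reflexive (trans (sym eq′) (ℕ.suc-injective (trans (sym eq) degree-c)))
    unseen (here refl) with others T (~-sym c~b)
    ... | R , pending , eq = R
      , (λ b~z z∉ → pending b~z (z∉ ∘ there ∘ there ∘ here))
      , subst (_≤ n) eq (degree-≢c (~⇒≢c (~-sym c~b)))
    unseen (there (here refl)) with others T (~-sym c~a)
    ... | R , pending , eq = R
      , (λ a~z z∉ → pending a~z (z∉ ∘ there ∘ there ∘ here))
      , subst (_≤ n) eq (degree-≢c (~⇒≢c (~-sym c~a)))

    result = total record
      { grown     = grow (grow (root c) (here refl) a∉ (~-sym c~a))
                         (there (here refl)) b∉ (~-sym c~b)
      ; embedding = emb₂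
      ; slack     = λ y∈ → i ∷ [] , proj₁ (unseen y∈)
          , (λ z∈ d → here (direction-unique
              (agreeOff-trans (collinear y∈) (agreeOff-sym (collinear z∈))) d))
          , proj₂ (unseen y∈)
      ; small     = λ y∉ → degree-≢c (y∉ ∘ there ∘ there ∘ here)
      }

  -- The vertex `c` goes to `u` and one neighbour to `v`. The new edge occupies no direction, so all
  -- `n` are left for the other `n` neighbours of `c`.
  add-edge : (e : Edge (complement (□^ n K k))) → T ⊆ᴵ □^ n K k +ₑ e
  add-edge e@(edge {u} {v} (u≢v , u≁v)) =
    embedding⇒⊆ᴵ {T} {G} (proj₁ result) (proj₁ (proj₂ result)) (proj₂ (proj₂ result))
    where
    G = □^ n K k +ₑ e
    open Graph G using () renaming (_~_ to _≈_; ~-sym to ≈-sym; ~-irrefl to ≈-irrefl)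
    open Growth {n} {k} T connected acyclic ℕ.≤-refl _≈_ ≈-sym ≈-irrefl u v
      (λ x≢u x≢v → mk⇔ [ id , ⊥-elim ∘ [ x≢u ∘ proj₁ , x≢v ∘ proj₁ ]′ ]′ inj₁)

    picked = member (subst (1 ≤_) (sym degree-c) (s≤s z≤n))
    a   = proj₁ picked
    c~a = ∈-neighbours⁻ T (proj₂ picked)

    a∉ : a ∉ c ∷ []
    a∉ (here eq) = ~⇒≢c (~-sym c~a) eq

    f : V T → V G
    f = update T a v (const u)

    emb : PartialEmbedding T _≈_ (a ∷ c ∷ []) f
    emb = extend T _≈_ ≈-sym ≈-irrefl (singleton T _≈_ ≈-sym ≈-irrefl c (const u)) a∉
      (λ where (here refl) → mk⇔ (λ _ → inj₂ (inj₂ (refl , refl))) (λ _ → ~-sym c~a))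
      (λ where (here refl) → u≢v ∘ sym)

    -- Directions refer to the unaltered product, where `u` and `v` are not adjacent; the initial
    -- slack can thus take an empty list of directions.
    isolated : ∀ {y z i} → y ∈ a ∷ c ∷ [] → z ∈ a ∷ c ∷ [] → ¬ DiffersAt i (f y) (f z)
    isolated (here refl) (here refl) d = here≢ d refl
    isolated (here refl) (there z∈@(here refl)) d = u≁v (differsAt⇒adjacent
      (subst₂ (DiffersAt _) (update-∈ T a∉ z∈) (update-≡ T a v (const u)) (differsAt-sym d)))
    isolated (there y∈@(here refl)) (here refl) d = u≁v (differsAt⇒adjacent
      (subst₂ (DiffersAt _) (update-∈ T a∉ y∈) (update-≡ T a v (const u)) d))
    isolated (there (here refl)) (there (here refl)) d = here≢ d refl

    unseen : ∀ {y} → y ∈ a ∷ c ∷ [] → ∃ λ R →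
             (∀ {z} → y ~ z → z ∉ a ∷ c ∷ [] → z ∈ R) × length R ≤ n
    unseen (here refl) with others T (~-sym c~a)
    ... | R , pending , eq = R
      , (λ a~z z∉ → pending a~z (z∉ ∘ there ∘ here))
      , ℕ.<⇒≤ (subst (_≤ n) eq (degree-≢c (~⇒≢c (~-sym c~a))))
    unseen (there (here refl)) with others T c~a
    ... | R , pending , eq = R
      , (λ c~z z∉ → pending c~z (z∉ ∘ here))
      , ℕ.≤-reflexive (ℕ.suc-injective (trans (sym eq) degree-c))

    result = total record
      { grown     = grow (root c) (here refl) a∉ (~-sym c~a)
      ; embedding = emb
      ; slack     = λ y∈ → [] , proj₁ (unseen y∈)
          , (λ z∈ d → ⊥-elim (isolated y∈ z∈ d))
          , proj₂ (unseen y∈)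
      ; small     = λ y∉ → degree-≢c (y∉ ∘ there ∘ here)
      }

-- Induced saturation for the trees of the class

corollary2 : (n : ℕ) → n ≥ 3 → (T : Graph) → 𝒯 n T →
    ∃ λ (k : ℕ) → k ≥ 1 × IsInducedSaturated T (□^ n K k)
corollary2 n@(suc _) n≥3 T t = k , s≤s z≤n , record
  { order≥2 = ≢⇒order≥2 (□^ n K k) {replicate n zero} {replicate n (suc zero)} λ ()
  ; free    = degree>n⇒⊈□ T acyclic c (ℕ.≤-reflexive (sym degree-c))
  ; remove  = remove-edge (s≤s z≤n)
  ; add     = add-edge
  }
  where
  open 𝒯 t
  acyclic = proj₂ tree
  degree-c : degree T c ≡ suc n
  degree-c = trans c-max (trans Δ≡n+1 (ℕ.+-comm n 1))
  -- All degrees are at most `n + 1`, and only `c` attains this maximum.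
  degree-≢c : ∀ {y} → y ≢ c → degree T y ≤ n
  degree-≢c {y} y≢c = s≤s⁻¹ (subst (degree T y <_) (trans (sym c-max) degree-c)
    (ℕ.≤∧≢⇒< (degree≤Δ T y) (y≢c ∘ c-unique y)))
  open Saturation T (proj₁ tree) acyclic c degree-c degree-≢c
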